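{- For every $i\ge 2$, $\lambda(T_i)=3$.
   Context: A formula is a finite set of non-empty words over variables (fragments), written separated by dots. An occurrence of a formula $f$ in a word $w$ over an alphabet $\Sigma$ is a non-erasing morphism $h$ from variables to non-empty words over $\Sigma$ such that $h(\phi)$ is a factor of $w$ for every fragment $\phi$; $\lambda(f)$ is the smallest size of an alphabet over which there exists an infinite word containing no occurrence of $f$. For $i\ge1$, $T_i$ is the formula on variables $A_0,\dots,A_{i-1}$ whose fragments are the $i$ words $A_jA_{j+1}A_j$, $0\le j\le i-1$, indices modulo $i$ (so $T_1=AAA$, $T_2=ABA.BAB$, $T_3=ABA.BCB.CAC$, etc.). -}

module Defs where

open import Data.Nat using (ℕ; zero; suc; _+_; _<_; _≤_)
open import Data.Nat.DivMod using (_%_; m%n<n)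
open import Data.Fin using (Fin; toℕ; fromℕ<)
open import Data.List using (List; []; _∷_; length; lookup; map; concatMap)
open import Data.List.NonEmpty using (List⁺; toList)
open import Data.List.Relation.Unary.All using (All)
open import Data.Fin using (zero; suc)
open import Data.List using (allFin)
open import Data.Product using (∃; Σ)
open import Relation.Binary.PropositionalEquality using (_≡_)
open import Relation.Nullary using (¬_)

InfWord : ℕ → Set
InfWord k = ℕ → Fin k

-- A formula on n variables (Fin n): a finite list of (non-empty) fragments.
Formula : ℕ → Set
Formula n = List (List (Fin n))

IsFactor : {k : ℕ} → List (Fin k) → InfWord k → Set
IsFactor u w = ∃ λ p → (j : Fin (length u)) → w (p + toℕ j) ≡ lookup u j

applyMorph : {n k : ℕ} → (Fin n → List⁺ (Fin k)) → List (Fin n) → List (Fin k)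
applyMorph h φ = concatMap (λ x → toList (h x)) φ

Occurrence : {n k : ℕ} → Formula n → InfWord k → Set
Occurrence {n} {k} f w =
  Σ (Fin n → List⁺ (Fin k)) λ h → All (λ φ → IsFactor (applyMorph h φ) w) f

Avoids : {n k : ℕ} → InfWord k → Formula n → Set
Avoids w f = ¬ Occurrence f w

AvoidableOver : {n : ℕ} → ℕ → Formula n → Set
AvoidableOver k f = Σ (InfWord k) λ w → Avoids w f

LambdaIs : {n : ℕ} → Formula n → ℕ → Set
LambdaIs f m = AvoidableOver m f Data.Product.× ((k : ℕ) → k < m → ¬ AvoidableOver k f)

sucMod : {i : ℕ} → Fin i → Fin i
sucMod {suc n} j = fromℕ< (m%n<n (suc (toℕ j)) (suc n))

T : (i : ℕ) → Formula i
T i = map (λ j → j ∷ sucMod j ∷ j ∷ []) (allFin i)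

{-# OPTIONS --safe #-}

-- Write u → v when uvu is a factor of the infinite word w.  An occurrence of Tᵢ in w is a
-- closed walk of length i for this relation.
--
-- Two closed walks through the same word, of lengths 2 and 3, yield closed walks of every
-- length i ≥ 2.  Every binary word of length 20 contains such a pair (a cube uuu is a
-- degenerate one), by exhaustive search.
--
-- Over three letters, we build a word in which u → v forces |u| < |v|, except when u and v
-- are letters, where it forces u < v; then 3|u| + (first letter of u) increases along →, so
-- there is no closed walk at all.  The word is a 100-periodic template with a hole at each
-- multiple of 25.  For a period p not divisible by 100, the template alone rules out the
-- repetitions uvu with |uv| = p and |u| ≥ |v|.  The holes are filled with a
-- Toeplitz sequence of bits, which rules them out when p is divisible by 100.

module Submission where

open import Defs
open import Data.Bool.Base as Bool using (Bool; false; _∧_; _∨_)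
open import Data.Bool.Properties using (T-∧)
open import Data.Fin.Base as Fin using (Fin; zero; suc; toℕ; fromℕ<)
import Data.Fin.Properties as Fin
open import Data.List.Base using (List; []; _∷_; _++_; length; lookup)
open import Data.List.NonEmpty.Base as List⁺ using (List⁺; toList; _∷_; head)
open import Data.List.Relation.Binary.Infix.Heterogeneous using (Infix; here; there)
open import Data.List.Relation.Binary.Infix.Heterogeneous.Properties using (infix?)
open import Data.List.Relation.Binary.Prefix.Heterogeneous using (Prefix; []; _∷_)
import Data.List.Relation.Unary.All.Properties as All
open import Data.List.Relation.Unary.Any using (any?; satisfied)
open import Data.Nat
open import Data.Nat.Binary.Base as ℕᵇ using (ℕᵇ; zero; 2[1+_]; 1+[2_])
import Data.Nat.Binary.Properties as ℕᵇ
open import Data.Nat.DivMod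
open import Data.Nat.Induction using (<-rec)
open import Data.Nat.Properties
open import Data.Nat.Tactic.RingSolver using (solve-∀)
open import Data.Parity.Base as ℙ using (Parity; 0ℙ; 1ℙ)
import Data.Parity.Properties as ℙ
open import Data.Product using (∃; _×_; _,_; proj₁; proj₂)
open import Data.Sum using (_⊎_; inj₁; inj₂)
open import Data.Unit using (⊤; tt)
open import Function.Base using (const; _∘_)
open import Function.Bundles using (Equivalence)
open import Relation.Binary.PropositionalEquality
open import Relation.Nullary using (Dec; yes; no; ¬_; ¬?)
open import Relation.Nullary.Decidable using (toWitness; map′; _×-dec_; _→-dec_; ⌊_⌋)
open import Relation.Unary using (Decidable)

-- Repetitions and the Toeplitz bit sequence.

-- An occurrence of `uvu` at position `s` yields this with `p` = |uv| and `l` = |u|.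
Agree : {A : Set} → (ℕ → A) → ℕ → ℕ → ℕ → Set
Agree f p s l = ∀ n → s ≤ n → n < s + l → f n ≡ f (n + p)

-- bit n is the second binary digit of n + 1 to the left of its lowest 1; the shift by one
-- makes the definition structural on ℕᵇ.
bitᵇ : ℕᵇ → Parity
bitᵇ zero     = 0ℙ
bitᵇ 2[1+ x ] = parity ⌊ suc (ℕᵇ.toℕ x) /2⌋
bitᵇ 1+[2 x ] = bitᵇ x

bit : ℕ → Parity
bit n = bitᵇ (ℕᵇ.fromℕ n)

bit-odd : ∀ n → bit (suc (2 * n)) ≡ bit n
bit-odd n = cong bitᵇ odd-form
  where
  odd-form : ℕᵇ.fromℕ (suc (2 * n)) ≡ 1+[2 ℕᵇ.fromℕ n ]
  odd-form = ℕᵇ.toℕ-injective (trans (ℕᵇ.toℕ-fromℕ _)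
    (cong (λ m → suc (2 * m)) (sym (ℕᵇ.toℕ-fromℕ n))))

bit-even : ∀ n → bit (2 * n) ≡ parity ⌊ n /2⌋
bit-even zero    = refl
bit-even (suc n) = begin
  bit (2 * suc n)                               ≡⟨ cong bitᵇ even-form ⟩
  parity ⌊ suc (ℕᵇ.toℕ (ℕᵇ.fromℕ n)) /2⌋  ≡⟨ cong (λ m → parity ⌊ suc m /2⌋) (ℕᵇ.toℕ-fromℕ n) ⟩
  parity ⌊ suc n /2⌋                        ∎
  where
  open ≡-Reasoning
  even-form : ℕᵇ.fromℕ (2 * suc n) ≡ 2[1+ ℕᵇ.fromℕ n ]
  even-form = ℕᵇ.toℕ-injective (trans (ℕᵇ.toℕ-fromℕ _)
    (cong (λ m → 2 * suc m) (sym (ℕᵇ.toℕ-fromℕ n))))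

2⌊n/2⌋≤n : ∀ n → 2 * ⌊ n /2⌋ ≤ n
2⌊n/2⌋≤n zero          = z≤n
2⌊n/2⌋≤n (suc zero)    = z≤n
2⌊n/2⌋≤n (suc (suc n)) =
  subst (_≤ suc (suc n)) (sym (*-suc 2 ⌊ n /2⌋)) (s≤s (s≤s (2⌊n/2⌋≤n n)))

n≤1+2⌊n/2⌋ : ∀ n → n ≤ suc (2 * ⌊ n /2⌋)
n≤1+2⌊n/2⌋ zero          = z≤n
n≤1+2⌊n/2⌋ (suc zero)    = ≤-refl
n≤1+2⌊n/2⌋ (suc (suc n)) =
  s≤s (subst (suc n ≤_) (sym (*-suc 2 ⌊ n /2⌋)) (s≤s (n≤1+2⌊n/2⌋ n)))

⌊2m+n/2⌋≡m+⌊n/2⌋ : ∀ m n → ⌊ 2 * m + n /2⌋ ≡ m + ⌊ n /2⌋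
⌊2m+n/2⌋≡m+⌊n/2⌋ zero    n = refl
⌊2m+n/2⌋≡m+⌊n/2⌋ (suc m) n rewrite +-suc m (m + 0) = cong suc (⌊2m+n/2⌋≡m+⌊n/2⌋ m n)

p≢p⁻¹ : ∀ p → p ≢ 1ℙ ℙ.+ p
p≢p⁻¹ 0ℙ ()
p≢p⁻¹ 1ℙ ()

-- By `bit-even`, the shift adds the odd number `suc (2 * r)` to the number whose parity is the bit.
bit-flip : ∀ r n → bit (2 * n) ≢ bit (2 * n + 4 * suc (2 * r))
bit-flip r n eq = p≢p⁻¹ (parity ⌊ n /2⌋) (begin
  parity ⌊ n /2⌋                                ≡⟨ bit-even n ⟨
  bit (2 * n)                                       ≡⟨ eq ⟩
  bit (2 * n + 4 * suc (2 * r))                     ≡⟨ cong bit (rearrange n r) ⟩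
  bit (2 * (2 * suc (2 * r) + n))                   ≡⟨ bit-even (2 * suc (2 * r) + n) ⟩
  parity ⌊ 2 * suc (2 * r) + n /2⌋              ≡⟨ cong parity (⌊2m+n/2⌋≡m+⌊n/2⌋ (suc (2 * r)) n) ⟩
  parity (suc (2 * r) + ⌊ n /2⌋)                ≡⟨ ℙ.+-homo-+ (suc (2 * r)) ⌊ n /2⌋ ⟩
  parity (suc (2 * r)) ℙ.+ parity ⌊ n /2⌋       ≡⟨ cong (ℙ._+ parity ⌊ n /2⌋) (odd r) ⟩
  1ℙ ℙ.+ parity ⌊ n /2⌋                         ∎)
  where
  open ≡-Reasoning
  rearrange : ∀ n r → 2 * n + 4 * suc (2 * r) ≡ 2 * (2 * suc (2 * r) + n)
  rearrange = solve-∀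
  odd : ∀ r → parity (suc (2 * r)) ≡ 1ℙ
  odd zero    = refl
  odd (suc r) rewrite +-suc r (r + 0) = odd r

round-up : ∀ s d .{{_ : NonZero d}} → ∃ λ m → s ≤ d * m × d * m < s + d
round-up s (suc d) = (s + d) / suc d , lower , upper
  where
  m = (s + d) / suc d
  division : s + d ≡ (s + d) % suc d + m * suc d
  division = m≡m%n+[m/n]*n (s + d) (suc d)
  lower : s ≤ suc d * m
  lower = +-cancelʳ-≤ d s _ (begin
    s + d                             ≡⟨ division ⟩
    (s + d) % suc d + m * suc d       ≤⟨ +-monoˡ-≤ _ (s≤s⁻¹ (m%n<n (s + d) (suc d))) ⟩
    d + m * suc d                     ≡⟨ cong (d +_) (*-comm m (suc d)) ⟩
    d + suc d * m                     ≡⟨ +-comm d _ ⟩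
    suc d * m + d                     ∎)
    where open ≤-Reasoning
  upper : suc d * m < s + suc d
  upper = begin-strict
    suc d * m   ≡⟨ *-comm (suc d) m ⟩
    m * suc d   ≤⟨ m/n*n≤m (s + d) (suc d) ⟩
    s + d       <⟨ n<1+n _ ⟩
    suc (s + d) ≡⟨ +-suc s d ⟨
    s + suc d   ∎
    where open ≤-Reasoning

even-or-odd : ∀ n → (∃ λ m → n ≡ 2 * m) ⊎ (∃ λ m → n ≡ suc (2 * m))
even-or-odd zero    = inj₁ (0 , refl)
even-or-odd (suc n) with even-or-odd n
... | inj₁ (m , eq) = inj₂ (m , cong suc eq)
... | inj₂ (m , eq) = inj₁ (suc m , trans (cong suc eq) (sym (*-suc 2 m)))

-- At odd positions, bit is bit itself, so an even q reduces to q / 2; an odd q flips the bit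
-- at every even position.
bit-no-long-run : ∀ q → 0 < q → ∀ s → ¬ Agree bit (4 * q) s (2 * q)
bit-no-long-run = <-rec _ step
  where
  step : ∀ q → (∀ {r} → r < q → 0 < r → ∀ s → ¬ Agree bit (4 * r) s (2 * r)) →
         0 < q → ∀ s → ¬ Agree bit (4 * q) s (2 * q)
  step q rec 0<q s agree with even-or-odd q
  -- The run has length `2 * q ≥ 2`, so it contains an even position.
  ... | inj₂ (r , refl) with n , s≤2n , 2n<s+2 ← round-up s 2 =
    bit-flip r n (agree (2 * n) s≤2n (<-≤-trans 2n<s+2 (+-monoʳ-≤ s (*-monoʳ-≤ 2 0<q))))
  ... | inj₁ (zero , refl) = n≮0 0<q
  -- The map `n ↦ 2n + 1` sends the `2 * r` positions from `⌊ s /2⌋` on into the run of length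
  -- `4 * r` from `s` on.
  ... | inj₁ (r@(suc _) , refl) = rec r<q z<s ⌊ s /2⌋ λ n lo hi → let open ≡-Reasoning in begin
    bit n                              ≡⟨ bit-odd n ⟨
    bit (suc (2 * n))                  ≡⟨ agree (suc (2 * n)) (above n lo) (below n hi) ⟩
    bit (suc (2 * n) + 4 * (2 * r))    ≡⟨ cong bit (shift n r) ⟩
    bit (suc (2 * (n + 4 * r)))        ≡⟨ bit-odd (n + 4 * r) ⟩
    bit (n + 4 * r)                    ∎
    where
    r<q : r < 2 * r
    r<q = m<m+n r z<s
    shift : ∀ n r → suc (2 * n) + 4 * (2 * r) ≡ suc (2 * (n + 4 * r))
    shift = solve-∀
    above : ∀ n → ⌊ s /2⌋ ≤ n → s ≤ suc (2 * n)
    above n lo = ≤-trans (n≤1+2⌊n/2⌋ s) (s≤s (*-monoʳ-≤ 2 lo))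
    below : ∀ n → n < ⌊ s /2⌋ + 2 * r → suc (2 * n) < s + 2 * (2 * r)
    below n hi = begin
      suc (suc (2 * n))               ≡⟨ *-suc 2 n ⟨
      2 * suc n                       ≤⟨ *-monoʳ-≤ 2 hi ⟩
      2 * (⌊ s /2⌋ + 2 * r)       ≡⟨ *-distribˡ-+ 2 ⌊ s /2⌋ (2 * r) ⟩
      2 * ⌊ s /2⌋ + 2 * (2 * r)   ≤⟨ +-monoˡ-≤ (2 * (2 * r)) (2⌊n/2⌋≤n s) ⟩
      s + 2 * (2 * r)                 ∎
      where open ≤-Reasoning

-- The ternary word and its repetitions.

-- The letter at a position, as a function of the bit available there: constant except at holes.
Slot : Set
Slot = Parity → Fin 3

a b c □ : Slot
a = const zero
b = const (suc zero)
c = const (suc (suc zero))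
□ 0ℙ = zero
□ 1ℙ = suc zero

-- Found by backtracking search.
template : List Slot
template =
  □ ∷ a ∷ c ∷ a ∷ b ∷ b ∷ c ∷ c ∷ a ∷ a ∷ c ∷ b ∷ b ∷ c ∷ a ∷ b ∷ a ∷ c ∷ c ∷ a ∷ a ∷ b ∷ c ∷ c ∷ b ∷
  □ ∷ a ∷ c ∷ a ∷ b ∷ b ∷ c ∷ b ∷ a ∷ c ∷ c ∷ a ∷ b ∷ a ∷ a ∷ c ∷ b ∷ b ∷ c ∷ c ∷ a ∷ a ∷ b ∷ c ∷ b ∷
  □ ∷ a ∷ c ∷ a ∷ b ∷ b ∷ c ∷ c ∷ a ∷ a ∷ c ∷ b ∷ b ∷ c ∷ a ∷ b ∷ a ∷ a ∷ c ∷ c ∷ b ∷ b ∷ a ∷ c ∷ a ∷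
  □ ∷ b ∷ c ∷ b ∷ a ∷ c ∷ c ∷ a ∷ b ∷ a ∷ a ∷ c ∷ b ∷ b ∷ c ∷ a ∷ a ∷ b ∷ a ∷ c ∷ c ∷ a ∷ b ∷ c ∷ b ∷ []

nth : List Slot → ℕ → Slot
-- This default is never reached by `slot`: the template has 100 entries and the index is reduced
-- modulo 100.
nth []       _       = a
nth (x ∷ _)  zero    = x
nth (_ ∷ xs) (suc n) = nth xs n

slot : ℕ → Slot
slot n = nth template (n % 100)

-- Dividing by 25 numbers the holes consecutively: the hole at `25 * m` receives `bit m`.
word : InfWord 3
word n = slot n (bit (n / 25))

allParities? : {P : Parity → Set} → Decidable P → Dec (∀ x → P x)
allParities? P? = map′ (λ { (p , q) → λ { 0ℙ → p ; 1ℙ → q } }) (λ f → f 0ℙ , f 1ℙ) (P? 0ℙ ×-dec P? 1ℙ)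

-- Letting both bits vary freely makes a clash depend on residues modulo 100 only, hence finitely
-- checkable.
Clash : Slot → Slot → Set
Clash f g = ∀ x y → f x ≢ g y

clash? : ∀ f g → Dec (Clash f g)
clash? f g = allParities? λ x → allParities? λ y → ¬? (f x Fin.≟ g y)

-- A lower bound for |u| when |u| ≥ |v| and |uv| ≥ 3 is congruent to ρ modulo 100: for ρ < 3
-- this forces |uv| ≥ 100.
window : ℕ → ℕ
window ρ@(suc (suc (suc _))) = ⌈ ρ /2⌉
window _ = 50

HasClash : ℕ → ℕ → Set
HasClash ρ σ = ∃ λ k → k < window ρ × Clash (slot (σ + k)) (slot (σ + k + ρ))

has-clash? : ∀ ρ σ → Dec (HasClash ρ σ)
has-clash? ρ σ = anyUpTo? (λ k → clash? (slot (σ + k)) (slot (σ + k + ρ))) (window ρ)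

-- Abstract, lest conversion checking unfold the exhaustive search.
abstract
  has-clash : ∀ {ρ} → ρ < 99 → ∀ {σ} → σ < 100 → HasClash (suc ρ) σ
  has-clash = toWitness {a? = allUpTo? (λ ρ → allUpTo? (λ σ → has-clash? (suc ρ) σ) 100) 99} _

abstract
  -- The case where `u` and `v` are letters, checked on all residues and all fillings of the holes.
  ascent : ∀ {σ} → σ < 100 → ∀ x y z →
           slot σ x ≡ slot (σ + 2) z → slot σ x Fin.< slot (σ + 1) y
  ascent = toWitness {a? = allUpTo? (λ σ →
    allParities? λ x → allParities? λ y → allParities? λ z →
    (slot σ x Fin.≟ slot (σ + 2) z) →-dec (slot σ x Fin.<? slot (σ + 1) y)) 100} _

slot-mod : ∀ n → slot (n % 100) ≡ slot n
slot-mod n = cong (nth template) (m%n%n≡m%n n 100)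

%-+-cong : ∀ {m m′ n n′} d .{{_ : NonZero d}} →
           m % d ≡ m′ % d → n % d ≡ n′ % d → (m + n) % d ≡ (m′ + n′) % d
%-+-cong {m} {m′} {n} {n′} d m≡m′ n≡n′ = begin
  (m + n) % d            ≡⟨ %-distribˡ-+ m n d ⟩
  (m % d + n % d) % d    ≡⟨ cong₂ (λ x y → (x + y) % d) m≡m′ n≡n′ ⟩
  (m′ % d + n′ % d) % d  ≡⟨ %-distribˡ-+ m′ n′ d ⟨
  (m′ + n′) % d          ∎
  where open ≡-Reasoning

slot-mod-+ : ∀ n k → slot (n % 100 + k) ≡ slot (n + k)
slot-mod-+ n k = cong (nth template) (%-+-cong {n % 100} {n} {k} {k} 100 (m%n%n≡m%n n 100) refl)

word-ascent : ∀ n → word n ≡ word (n + 2) → word n Fin.< word (n + 1)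
word-ascent n eq = subst₂ (λ f g → f (bit (n / 25)) Fin.< g (bit ((n + 1) / 25)))
  (slot-mod n) (slot-mod-+ n 1)
  (ascent (m%n<n n 100) _ _ (bit ((n + 2) / 25)) (begin
    slot (n % 100) (bit (n / 25))            ≡⟨ cong-app (slot-mod n) _ ⟩
    word n                                   ≡⟨ eq ⟩
    word (n + 2)                             ≡⟨ cong-app (slot-mod-+ n 2) _ ⟨
    slot (n % 100 + 2) (bit ((n + 2) / 25))  ∎))
  where open ≡-Reasoning

window≤ : ∀ p l → 3 ≤ p → p ≤ 2 * l → window (p % 100) ≤ l
window≤ p l 3≤p p≤2l = bound (p % 100) (λ ρ<3 → *-cancelˡ-≤ 2 (≤-trans (100≤p ρ<3) p≤2l))
  (≤-trans (m%n≤m p 100) p≤2l)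
  where
  100≤p : p % 100 < 3 → 100 ≤ p
  100≤p ρ<3 = ≮⇒≥ λ p<100 → <⇒≱ (subst (_< 3) (m<n⇒m%n≡m p<100) ρ<3) 3≤p
  bound : ∀ ρ → (ρ < 3 → 50 ≤ l) → ρ ≤ 2 * l → window ρ ≤ l
  bound 0 50≤l _ = 50≤l (s≤s z≤n)
  bound 1 50≤l _ = 50≤l (s≤s (s≤s z≤n))
  bound 2 50≤l _ = 50≤l (s≤s (s≤s (s≤s z≤n)))
  bound ρ@(suc (suc (suc _))) _ ρ≤2l = subst (⌈ ρ /2⌉ ≤_)
    (trans (cong ⌊_/2⌋ (+-comm 1 (2 * l))) (trans (⌊2m+n/2⌋≡m+⌊n/2⌋ l 1) (+-identityʳ l)))
    (⌈n/2⌉-mono ρ≤2l)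

word-hole : ∀ m → word (25 * m) ≡ □ (bit m)
word-hole m = cong₂ (λ f k → f (bit k)) slot-hole
  (trans (cong (_/ 25) (*-comm 25 m)) (m*n/n≡m m 25))
  where
  first-holes : ∀ r → r < 4 → slot (25 * r) ≡ □
  first-holes 0 _ = refl
  first-holes 1 _ = refl
  first-holes 2 _ = refl
  first-holes 3 _ = refl
  first-holes (suc (suc (suc (suc _)))) (s≤s (s≤s (s≤s (s≤s ()))))
  expand : ∀ r q → 25 * (r + q * 4) ≡ 25 * r + q * 100
  expand = solve-∀
  slot-hole : slot (25 * m) ≡ □
  slot-hole = begin
    slot (25 * m)                        ≡⟨ cong (λ k → slot (25 * k)) (m≡m%n+[m/n]*n m 4) ⟩
    slot (25 * (m % 4 + m / 4 * 4))      ≡⟨ cong slot (expand (m % 4) (m / 4)) ⟩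
    slot (25 * (m % 4) + m / 4 * 100)    ≡⟨ cong (nth template) ([m+kn]%n≡m%n (25 * (m % 4)) (m / 4) 100) ⟩
    slot (25 * (m % 4))                  ≡⟨ first-holes (m % 4) (m%n<n m 4) ⟩
    □                                    ∎
    where open ≡-Reasoning

□-injective : ∀ {x y} → □ x ≡ □ y → x ≡ y
□-injective {0ℙ} {0ℙ} _ = refl
□-injective {1ℙ} {1ℙ} _ = refl

word-no-long-run : ∀ p s l → 3 ≤ p → p ≤ 2 * l → ¬ Agree word p s l
word-no-long-run p s l 3≤p p≤2l agree with p % 100 in ρ-eq
-- The template has a clash at an offset `k` below the window, hence inside the run.
... | suc ρ = clash _ _ (begin
    slot (s % 100 + k) _                  ≡⟨ cong-app (slot-mod-+ s k) _ ⟩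
    word (s + k)                          ≡⟨ agree (s + k) (m≤m+n s k) (+-monoʳ-< s k<l) ⟩
    word (s + k + p)                      ≡⟨ cong-app (cong (nth template) residue) _ ⟨
    slot (s % 100 + k + suc ρ) _          ∎)
  where
  open ≡-Reasoning
  1+ρ<100 : suc ρ < 100
  1+ρ<100 = subst (_< 100) ρ-eq (m%n<n p 100)
  found : HasClash (suc ρ) (s % 100)
  found = has-clash (s≤s⁻¹ 1+ρ<100) (m%n<n s 100)
  k = proj₁ found
  clash = proj₂ (proj₂ found)
  k<l : k < l
  k<l = <-≤-trans (proj₁ (proj₂ found)) (subst (λ r → window r ≤ l) ρ-eq (window≤ p l 3≤p p≤2l))
  residue : (s % 100 + k + suc ρ) % 100 ≡ (s + k + p) % 100
  residue = %-+-cong {s % 100 + k} {s + k} {suc ρ} {p} 100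
    (%-+-cong {s % 100} {s} {k} {k} 100 (m%n%n≡m%n s 100) refl)
    (trans (m<n⇒m%n≡m 1+ρ<100) (sym ρ-eq))
-- Here `p = 100 * q` is a shift by `4 * q` holes. As `50 * q ≤ l`, the run contains `2 * q`
-- consecutive holes, starting with the first one at or after `s`.
... | zero = bit-no-long-run q 0<q m₀ λ m lo hi → let open ≡-Reasoning in □-injective (begin
    □ (bit m)                 ≡⟨ word-hole m ⟨
    word (25 * m)             ≡⟨ agree (25 * m) (≤-trans s≤25m₀ (*-monoʳ-≤ 25 lo)) (below m hi) ⟩
    word (25 * m + p)         ≡⟨ cong (λ r → word (25 * m + r)) p≡q*100 ⟩
    word (25 * m + q * 100)   ≡⟨ cong word (collect m q) ⟩
    word (25 * (m + 4 * q))   ≡⟨ word-hole (m + 4 * q) ⟩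
    □ (bit (m + 4 * q))       ∎)
  where
  q = p / 100
  p≡q*100 : p ≡ q * 100
  p≡q*100 = trans (m≡m%n+[m/n]*n p 100) (cong (_+ q * 100) ρ-eq)
  0<q : 0 < q
  0<q = n≢0⇒n>0 λ q≡0 → <⇒≱ (s≤s z≤n) (subst (3 ≤_) (trans p≡q*100 (cong (_* 100) q≡0)) 3≤p)
  m₀ = proj₁ (round-up s 25)
  s≤25m₀ = proj₁ (proj₂ (round-up s 25))
  25m₀<s+25 = proj₂ (proj₂ (round-up s 25))
  collect : ∀ m q → 25 * m + q * 100 ≡ 25 * (m + 4 * q)
  collect = solve-∀
  50q≤l : 50 * q ≤ l
  50q≤l = *-cancelˡ-≤ 2 (subst (_≤ 2 * l) (trans p≡q*100 (double q)) p≤2l)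
    where
    double : ∀ q → q * 100 ≡ 2 * (50 * q)
    double = solve-∀
  below : ∀ m → m < m₀ + 2 * q → 25 * m < s + l
  below m hi = +-cancelˡ-< 25 _ _ (begin-strict
    25 + 25 * m            ≡⟨ *-suc 25 m ⟨
    25 * suc m             ≤⟨ *-monoʳ-≤ 25 hi ⟩
    25 * (m₀ + 2 * q)      ≡⟨ distribute m₀ q ⟩
    25 * m₀ + 50 * q       <⟨ +-mono-<-≤ 25m₀<s+25 50q≤l ⟩
    s + 25 + l             ≡⟨ commute s l ⟩
    25 + (s + l)           ∎)
    where
    open ≤-Reasoning
    distribute : ∀ m q → 25 * (m + 2 * q) ≡ 25 * m + 50 * q
    distribute = solve-∀
    commute : ∀ s l → s + 25 + l ≡ 25 + (s + l)
    commute = solve-∀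

-- Reading factors at a given position.

module _ {k} (w : InfWord k) where

  -- Fixing the position and recursing on the word, unlike `IsFactor`, lets a reading be split along
  -- `_++_`.
  Reads : ℕ → List (Fin k) → Set
  Reads p []      = ⊤
  Reads p (x ∷ u) = w p ≡ x × Reads (suc p) u

  fromReads : ∀ u {p} → Reads p u → IsFactor u w
  fromReads u {p} r = p , letters u r
    where
    letters : ∀ u {p} → Reads p u → ∀ j → w (p + toℕ j) ≡ lookup u j
    letters (x ∷ u) {p} (eq , r) zero    = trans (cong w (+-identityʳ p)) eq
    letters (x ∷ u) {p} (eq , r) (suc j) = trans (cong w (+-suc p (toℕ j))) (letters u r j)

  toReads : ∀ u → ((p , _) : IsFactor u w) → Reads p u
  toReads []      _         = tt
  toReads (x ∷ u) (p , eqs) = trans (cong w (sym (+-identityʳ p))) (eqs zero) ,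
    toReads u (suc p , λ j → trans (cong w (sym (+-suc p (toℕ j)))) (eqs (suc j)))

  Reads-++⁻ : ∀ u {v p} → Reads p (u ++ v) → Reads p u × Reads (p + length u) v
  Reads-++⁻ [] {v} {p} r = tt , subst (λ q → Reads q v) (sym (+-identityʳ p)) r
  Reads-++⁻ (x ∷ u) {v} {p} (eq , r) with ru , rv ← Reads-++⁻ u r =
    (eq , ru) , subst (λ q → Reads q v) (sym (+-suc p (length u))) rv

  Reads-unique : ∀ u {p q} → Reads p u → Reads q u → ∀ n → n < length u → w (p + n) ≡ w (q + n)
  Reads-unique (x ∷ u) {p} {q} (eq , _) (eq′ , _) zero _ =
    trans (cong w (+-identityʳ p)) (trans (trans eq (sym eq′)) (cong w (sym (+-identityʳ q))))
  Reads-unique (x ∷ u) {p} {q} (_ , r) (_ , r′) (suc n) (s≤s n<l) =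
    trans (cong w (+-suc p n)) (trans (Reads-unique u r r′ n n<l) (cong w (sym (+-suc q n))))

  Reads-agree : ∀ u {s p} → Reads s u → Reads (s + p) u → Agree w p s (length u)
  Reads-agree u {s} {p} r r′ n s≤n n<s+l = begin
    w n                   ≡⟨ cong w (m+[n∸m]≡n s≤n) ⟨
    w (s + (n ∸ s))       ≡⟨ Reads-unique u r r′ (n ∸ s) n∸s<l ⟩
    w (s + p + (n ∸ s))   ≡⟨ cong w (swap s p (n ∸ s)) ⟩
    w (s + (n ∸ s) + p)   ≡⟨ cong (λ m → w (m + p)) (m+[n∸m]≡n s≤n) ⟩
    w (n + p)             ∎
    where
    open ≡-Reasoning
    n∸s<l : n ∸ s < length u
    n∸s<l = +-cancelˡ-< s _ _ (subst (_< s + length u) (sym (m+[n∸m]≡n s≤n)) n<s+l)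
    swap : ∀ a b c → a + b + c ≡ a + c + b
    swap = solve-∀

  Reads-prefix : ∀ {u r p} → Reads p r → Prefix _≡_ u r → Reads p u
  Reads-prefix _        []          = tt
  Reads-prefix (eq , r) (refl ∷ pre) = eq , Reads-prefix r pre

  Infix⇒IsFactor : ∀ {u r p} → Reads p r → Infix _≡_ u r → IsFactor u w
  Infix⇒IsFactor reads       (here pre)  = fromReads _ (Reads-prefix reads pre)
  Infix⇒IsFactor (_ , reads) (there inf) = Infix⇒IsFactor reads inf

-- Occurrences as closed walks.

-- The trailing `[]` makes this definitionally equal to the image of a fragment under `applyMorph`.
sandwich : ∀ {k} → List⁺ (Fin k) → List⁺ (Fin k) → List (Fin k)
sandwich u v = toList u ++ toList v ++ toList u ++ []

Edge : ∀ {k} → InfWord k → List⁺ (Fin k) → List⁺ (Fin k) → Set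
Edge w u v = IsFactor (sandwich u v) w

toOccurrence : ∀ {k n} (w : InfWord k) (h : Fin n → List⁺ (Fin k)) →
               (∀ j → Edge w (h j) (h (sucMod j))) → Occurrence (T n) w
toOccurrence w h edges = h , All.map⁺ (All.tabulate⁺ edges)

fromOccurrence : ∀ {k n} (w : InfWord k) → ((h , _) : Occurrence (T n) w) → ∀ j → Edge w (h j) (h (sucMod j))
fromOccurrence w (h , occ) = All.tabulate⁻ (All.map⁻ occ)

-- Following `sucMod` for `suc n` steps from index 0 leads back to it, while `f` gains at least 1 at
-- each step.
no-cyclic-ascent : ∀ {n} (f : Fin (suc n) → ℕ) → ¬ (∀ j → f j < f (sucMod j))
no-cyclic-ascent {n} f ascends = m+1+n≰m (f (index 0)) (≤-trans (climb (suc n)) (≤-reflexive (cong f wrap)))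
  where
  index : ℕ → Fin (suc n)
  index m = fromℕ< (m%n<n m (suc n))
  toℕ-index : ∀ m → toℕ (index m) ≡ m % suc n
  toℕ-index m = Fin.toℕ-fromℕ< (m%n<n m (suc n))
  wrap : index (suc n) ≡ index 0
  wrap = Fin.toℕ-injective (trans (toℕ-index (suc n)) (trans (n%n≡0 (suc n)) (sym (toℕ-index 0))))
  next : ∀ m → sucMod (index m) ≡ index (suc m)
  next m = Fin.toℕ-injective (begin
    toℕ (sucMod (index m))         ≡⟨ toℕ-index (suc (toℕ (index m))) ⟩
    suc (toℕ (index m)) % suc n    ≡⟨ cong (λ r → suc r % suc n) (toℕ-index m) ⟩
    suc (m % suc n) % suc n        ≡⟨ %-+-cong {1} {1} {m % suc n} {m} (suc n) refl (m%n%n≡m%n m (suc n)) ⟩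
    suc m % suc n                  ≡⟨ toℕ-index (suc m) ⟨
    toℕ (index (suc m))            ∎)
    where open ≡-Reasoning
  climb : ∀ m → f (index 0) + m ≤ f (index m)
  climb zero    = ≤-reflexive (+-identityʳ _)
  climb (suc m) = begin
    f (index 0) + suc m      ≡⟨ +-suc (f (index 0)) m ⟩
    suc (f (index 0) + m)    ≤⟨ s≤s (climb m) ⟩
    suc (f (index m))        ≤⟨ ascends (index m) ⟩
    f (sucMod (index m))     ≡⟨ cong f (next m) ⟩
    f (index (suc m))        ∎
    where open ≤-Reasoning

-- Avoidance over three letters.

-- Letters are less than 3, so this compares lengths first and breaks ties by the first letter.
∥_∥ : List⁺ (Fin 3) → ℕ
∥ u ∥ = 3 * List⁺.length u + toℕ (head u)

longer⇒∥<∥ : ∀ u v → List⁺.length u < List⁺.length v → ∥ u ∥ < ∥ v ∥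
longer⇒∥<∥ u v u<v = begin-strict
  3 * List⁺.length u + toℕ (head u)   <⟨ +-monoʳ-< (3 * List⁺.length u) (Fin.toℕ<n (head u)) ⟩
  3 * List⁺.length u + 3              ≡⟨ trans (+-comm _ 3) (sym (*-suc 3 (List⁺.length u))) ⟩
  3 * suc (List⁺.length u)            ≤⟨ *-monoʳ-≤ 3 u<v ⟩
  3 * List⁺.length v                  ≤⟨ m≤m+n _ _ ⟩
  ∥ v ∥                               ∎
  where open ≤-Reasoning

-- If |v| ≤ |u|, the two copies of `u` in `uvu`, at distance |uv| ≤ 2|u|, form a repetition excluded
-- by `word-no-long-run`.
Edge⇒length< : ∀ u v → 3 ≤ List⁺.length u + List⁺.length v → Edge word u v →
               List⁺.length u < List⁺.length v
Edge⇒length< u v 3≤ e@(p , _) = ≰⇒> λ v≤u →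
  word-no-long-run _ p (List⁺.length u) 3≤
    (+-monoʳ-≤ (List⁺.length u) (≤-trans v≤u (≤-reflexive (sym (+-identityʳ _)))))
    (Reads-agree word (toList u) first last)
  where
  split₁ = Reads-++⁻ word (toList u) (toReads word (sandwich u v) e)
  split₂ = Reads-++⁻ word (toList v) (proj₂ split₁)
  first : Reads word p (toList u)
  first = proj₁ split₁
  last : Reads word (p + (List⁺.length u + List⁺.length v)) (toList u)
  last = subst (λ q → Reads word q (toList u)) (+-assoc p _ _) (proj₁ (Reads-++⁻ word (toList u) (proj₂ split₂)))

Edge⇒∥<∥ : ∀ u v → Edge word u v → ∥ u ∥ < ∥ v ∥
Edge⇒∥<∥ (x ∷ []) (y ∷ []) e@(p , _)
  with eq₀ , eq₁ , eq₂ , _ ← toReads word (x ∷ y ∷ x ∷ []) e =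
  +-monoʳ-< 3 (subst₂ Fin._<_ eq₀ (trans (cong word (+-comm p 1)) eq₁)
    (word-ascent p (trans eq₀ (trans (sym eq₂) (cong word (+-comm 2 p))))))
Edge⇒∥<∥ u@(_ ∷ []) v@(_ ∷ _ ∷ _) e =
  longer⇒∥<∥ u v (Edge⇒length< u v (s≤s (s≤s (s≤s z≤n))) e)
Edge⇒∥<∥ u@(_ ∷ _ ∷ us) v@(_ ∷ vs) e =
  longer⇒∥<∥ u v (Edge⇒length< u v (s≤s (s≤s (≤-trans (s≤s z≤n) (m≤n+m (suc (length vs)) (length us))))) e)

word-avoids-T : ∀ n → Avoids word (T (suc n))
word-avoids-T n occ@(h , _) = no-cyclic-ascent (∥_∥ ∘ h) λ j →
  Edge⇒∥<∥ (h j) (h (sucMod j)) (fromOccurrence word occ j)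

-- Closed walks of every length from lengths 2 and 3.

record Rich {k} (w : InfWord k) : Set where
  field
    u v x y : List⁺ (Fin k)
    uvu : Edge w u v
    vuv : Edge w v u
    uxu : Edge w u x
    xyx : Edge w x y
    yuy : Edge w y u

module _ {A : Set} (E : A → A → Set) {u v x y : A}
         (uv : E u v) (vu : E v u) (ux : E u x) (xy : E x y) (yu : E y u) where

  record ClosedWalk (n : ℕ) : Set where
    field
      at    : ℕ → A
      start : at 0 ≡ u
      end   : at n ≡ u
      step  : ∀ {j} → j < n → E (at j) (at (suc j))

  -- Start from the walk of length 2 or 3, according to parity, and prepend the walk of length 2
  -- repeatedly.
  closedWalk : ∀ n → ClosedWalk (2 + n)
  closedWalk 0 = record
    { at    = λ { 1 → v ; _ → u }
    ; start = refl
    ; end   = refl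
    ; step  = λ { {0} _ → uv ; {1} _ → vu ; {suc (suc _)} (s≤s (s≤s ())) }
    }
  closedWalk 1 = record
    { at    = λ { 1 → x ; 2 → y ; _ → u }
    ; start = refl
    ; end   = refl
    ; step  = λ { {0} _ → ux ; {1} _ → xy ; {2} _ → yu ; {suc (suc (suc _))} (s≤s (s≤s (s≤s ()))) }
    }
  closedWalk (suc (suc n)) = record
    { at    = λ { 0 → u ; 1 → v ; (suc (suc j)) → at j }
    ; start = refl
    ; end   = end
    ; step  = λ { {0} _ → uv ; {1} _ → subst (E v) (sym start) vu ; {suc (suc j)} (s≤s (s≤s j<n)) → step j<n }
    }
    where open ClosedWalk (closedWalk n)

Rich⇒Occurrence : ∀ {k} {w : InfWord k} → Rich w → ∀ n → Occurrence (T (2 + n)) w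
Rich⇒Occurrence {w = w} rich n = toOccurrence w (at ∘ toℕ) λ j →
  subst (Edge w (at (toℕ j)))
    (trans (sym (wrap (Fin.toℕ<n j))) (cong at (sym (Fin.toℕ-fromℕ< (m%n<n (suc (toℕ j)) (2 + n))))))
    (step (Fin.toℕ<n j))
  where
  open Rich rich
  open ClosedWalk (closedWalk (Edge w) uvu vuv uxu xyx yuy n)
  -- At the last index `sucMod` returns to 0, where the walk has the same vertex as at its end.
  wrap : ∀ {m} → m < 2 + n → at (suc m % (2 + n)) ≡ at (suc m)
  wrap {m} m<i with m≤n⇒m<n∨m≡n m<i
  ... | inj₁ 1+m<i = cong at (m<n⇒m%n≡m 1+m<i)
  ... | inj₂ refl  = trans (cong at (n%n≡0 (2 + n))) (trans start (sym end))

-- Unavoidability over one and two letters.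

unary-rich : (w : InfWord 1) → Rich w
unary-rich w = record
  { u = zero ∷ [] ; v = zero ∷ [] ; x = zero ∷ [] ; y = zero ∷ []
  ; uvu = edge ; vuv = edge ; uxu = edge ; xyx = edge ; yuy = edge
  }
  where
  edge : Edge w (zero ∷ []) (zero ∷ [])
  edge = fromReads w (zero ∷ zero ∷ zero ∷ []) {0} (unique 0 , unique 1 , unique 2 , tt)
    where
    unique : ∀ n → w n ≡ zero
    unique n with zero ← w n = refl

Quadruple : Set
Quadruple = (List⁺ (Fin 2) × List⁺ (Fin 2)) × (List⁺ (Fin 2) × List⁺ (Fin 2))

cube : List⁺ (Fin 2) → Quadruple
cube u = (u , u) , (u , u)

pattern O = zero
pattern I = suc zero

-- A set of candidates for (u , v) , (x , y), found by a greedy covering of the binary words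
-- of length 20.
quadruples : List Quadruple
quadruples =
  cube (O ∷ []) ∷
  cube (I ∷ []) ∷
  (((I ∷ []) , (O ∷ [])) , ((I ∷ O ∷ []) , (O ∷ []))) ∷
  cube (I ∷ O ∷ []) ∷
  (((I ∷ []) , (O ∷ [])) , ((O ∷ I ∷ []) , (I ∷ O ∷ []))) ∷
  (((O ∷ []) , (I ∷ [])) , ((I ∷ O ∷ []) , (O ∷ I ∷ []))) ∷
  cube (I ∷ O ∷ I ∷ []) ∷
  cube (O ∷ I ∷ O ∷ []) ∷
  (((I ∷ O ∷ []) , (O ∷ [])) , ((O ∷ []) , (O ∷ I ∷ []))) ∷
  (((O ∷ I ∷ []) , (I ∷ [])) , ((I ∷ []) , (I ∷ O ∷ []))) ∷
  cube (O ∷ I ∷ I ∷ O ∷ I ∷ []) ∷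
  cube (I ∷ O ∷ O ∷ I ∷ O ∷ []) ∷
  cube (O ∷ I ∷ I ∷ O ∷ []) ∷
  cube (O ∷ I ∷ []) ∷ []

Within : List (Fin 2) → List⁺ (Fin 2) → List⁺ (Fin 2) → Set
Within r u v = Infix _≡_ (sandwich u v) r

RichIn : List (Fin 2) → Quadruple → Set
RichIn r ((u , v) , (x , y)) = Within r u v × Within r v u × Within r u x × Within r x y × Within r y u

richIn? : ∀ r c → Dec (RichIn r c)
richIn? r ((u , v) , (x , y)) =
  within? u v ×-dec within? v u ×-dec within? u x ×-dec within? x y ×-dec within? y u
  where
  within? : ∀ u v → Dec (Within r u v)
  within? u v = infix? Fin._≟_ (sandwich u v) r

-- Words are extended to the left, from position n down to 0, so that extension is consing.
rich : ℕ → List (Fin 2) → Bool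
rich-extensions : ℕ → List (Fin 2) → Bool
rich n r = ⌊ any? (richIn? r) quadruples ⌋ ∨ rich-extensions n r
rich-extensions zero    r = false
rich-extensions (suc n) r = rich n (zero ∷ r) ∧ rich n (suc zero ∷ r)

RichIn⇒Rich : ∀ {r p} {w : InfWord 2} → Reads w p r → ∃ (RichIn r) → Rich w
RichIn⇒Rich {w = w} reads (((u , v) , (x , y)) , uvu , vuv , uxu , xyx , yuy) = record
  { u = u ; v = v ; x = x ; y = y
  ; uvu = edge u v uvu ; vuv = edge v u vuv ; uxu = edge u x uxu ; xyx = edge x y xyx ; yuy = edge y u yuy
  }
  where
  edge : ∀ u v → Within _ u v → Edge w u v
  edge u v = Infix⇒IsFactor w reads

-- The word `w` selects one branch of the search tree: its letter at the next position to the left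
-- decides which conjunct to follow, until a quadruple is found.
rich-sound : ∀ n {r} {w : InfWord 2} → Reads w n r → Bool.T (rich n r) → Rich w
rich-sound n {r} reads t with any? (richIn? r) quadruples
... | yes found = RichIn⇒Rich reads (satisfied found)
rich-sound zero reads () | no _
rich-sound (suc n) {w = w} reads t | no _ with w n in eq | Equivalence.to T-∧ t
... | zero     | t₀ , _ = rich-sound n (eq , reads) t₀
... | suc zero | _ , t₁ = rich-sound n (eq , reads) t₁

abstract
  binary-rich : (w : InfWord 2) → Rich w
  -- The search starts from the empty word at position 20; the last `tt` makes the type checker
  -- evaluate it.
  binary-rich w = rich-sound 20 {[]} tt tt

theorem12 : (i : ℕ) → 2 ≤ i → LambdaIs (T i) 3
theorem12 (suc (suc n)) (s≤s (s≤s z≤n)) = (word , word-avoids-T (suc n)) , unavoidable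
  where
  unavoidable : ∀ k → k < 3 → ¬ AvoidableOver k (T (2 + n))
  unavoidable 0 _ (w , _) with () ← w 0
  unavoidable 1 _ (w , avoids) = avoids (Rich⇒Occurrence (unary-rich w) n)
  unavoidable 2 _ (w , avoids) = avoids (Rich⇒Occurrence (binary-rich w) n)
  unavoidable (suc (suc (suc _))) (s≤s (s≤s (s≤s ())))
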